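{- For every even integer $n\ge 6$ there exists an $n$-intersection polished graph with exactly $n^2/4+3n/2$ vertices that has at least $2^{n/2}$ maximal cliques. Consequently, there is an infinite family of graphs $G$, each $k$-intersection polished for a suitable $k$ depending on $G$, whose number of maximal cliques is exponential in $\sqrt{|V(G)|}$.
   Context: All graphs are finite and simple. For a vertex $v$, $N[v]$ denotes its closed neighbourhood (the set of neighbours of $v$ together with $v$). For an integer $k$, $P^k(G)$ is the graph on the same vertex set as $G$ in which two distinct vertices $u,v$ are adjacent if and only if $|N[u]\cap N[v]|\ge k$, the closed neighbourhoods being taken in $G$. A graph $G$ is called $k$-intersection polished if $P^k(G)=G$. A clique is a set of pairwise adjacent vertices; it is maximal if it is not properly contained in another clique. -}

module Defs where

open import Data.Bool using (_∨_)
open import Data.Fin using (Fin)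
open import Data.Fin.Properties using (_≟_; all?)
open import Data.Fin.Subset using (Subset; _∈_; _∩_; _⊂_; ∣_∣; inside; outside)
open import Data.Fin.Subset.Properties using (_∈?_; _⊂?_; anySubset?; ∩-comm)
open import Data.List using (List; []; _∷_; _++_; map; filter; length)
open import Data.List.Membership.Propositional using () renaming (_∈_ to _∈ˡ_)
open import Data.List.Membership.Propositional.Properties
  using (∈-map⁺; ∈-map⁻; ∈-++⁺ˡ; ∈-++⁺ʳ)
open import Data.List.Relation.Unary.All using ([])
open import Data.List.Relation.Unary.AllPairs using ([]; _∷_)
open import Data.List.Relation.Unary.Any using (here)
open import Data.List.Relation.Unary.Unique.Propositional using (Unique)
import Data.List.Relation.Unary.Unique.Propositional.Properties as Unique
open import Data.Nat using (ℕ; zero; suc; NonZero; _≤_; _≤?_; _*_; _^_)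
open import Data.Product using (∃; _×_; _,_; proj₂; ∃-syntax; Σ-syntax)
open import Data.Vec using ([]; _∷_; tabulate)
open import Data.Vec.Properties using (∷-injectiveʳ)
open import Function using (_∘_; _↔_; _⇔_; Inverse)
open import Level using (0ℓ)
open import Relation.Binary using (Rel; Symmetric; Irreflexive; Decidable)
open import Relation.Binary.PropositionalEquality using (_≡_; _≢_; refl; sym; subst)
open import Relation.Nullary using (Dec; does; ¬_; ¬?; _×-dec_; _→-dec_)

record Graph (n : ℕ) : Set₁ where
  field
    Adj    : Rel (Fin n) 0ℓ
    adj?   : Decidable Adj
    symm   : Symmetric Adj
    irrefl : Irreflexive _≡_ Adj

open Graph public

private
  variable
    m n : ℕ

infix 4 _≈_ _≅_
infix 8 _N[_]

_≈_ : Graph n → Graph n → Set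
G ≈ H = ∀ u v → Adj G u v ⇔ Adj H u v

_≅_ : Graph m → Graph n → Set
_≅_ {m} {n} G H =
  Σ[ f ∈ Fin m ↔ Fin n ] (∀ u v → Adj G u v ⇔ Adj H (Inverse.to f u) (Inverse.to f v))

_N[_] : (G : Graph n) → Fin n → Subset n
G N[ v ] = tabulate λ u → does (u ≟ v) ∨ does (adj? G v u)

P^ : ℕ → Graph n → Graph n
P^ k G = record
  { Adj    = λ u v → u ≢ v × k ≤ ∣ G N[ u ] ∩ G N[ v ] ∣
  ; adj?   = λ u v → ¬? (u ≟ v) ×-dec (k ≤? ∣ G N[ u ] ∩ G N[ v ] ∣)
  ; symm   = λ {u} {v} (u≢v , k≤) →
      u≢v ∘ sym , subst (λ S → k ≤ ∣ S ∣) (∩-comm (G N[ u ]) (G N[ v ])) k≤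
  ; irrefl = λ u≡v (u≢v , _) → u≢v u≡v
  }

IntersectionPolished : ℕ → Graph n → Set
IntersectionPolished k G = P^ k G ≈ G

IsClique : Graph n → Subset n → Set
IsClique G S = ∀ u v → u ∈ S → v ∈ S → u ≢ v → Adj G u v

isClique? : (G : Graph n) (S : Subset n) → Dec (IsClique G S)
isClique? G S = all? λ u → all? λ v →
  (u ∈? S) →-dec ((v ∈? S) →-dec (¬? (u ≟ v) →-dec adj? G u v))

IsMaximalClique : Graph n → Subset n → Set
IsMaximalClique G S = IsClique G S × ¬ (∃[ T ] IsClique G T × S ⊂ T)

isMaximalClique? : (G : Graph n) (S : Subset n) → Dec (IsMaximalClique G S)
isMaximalClique? G S =
  isClique? G S ×-dec ¬? (anySubset? λ T → isClique? G T ×-dec (S ⊂? T))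

allSubsets : (n : ℕ) → List (Subset n)
allSubsets zero    = [] ∷ []
allSubsets (suc n) = map (outside ∷_) (allSubsets n) ++ map (inside ∷_) (allSubsets n)

∈-allSubsets : (S : Subset n) → S ∈ˡ allSubsets n
∈-allSubsets []            = here refl
∈-allSubsets (outside ∷ S) = ∈-++⁺ˡ (∈-map⁺ (outside ∷_) (∈-allSubsets S))
∈-allSubsets (inside  ∷ S) =
  ∈-++⁺ʳ (map (outside ∷_) (allSubsets _)) (∈-map⁺ (inside ∷_) (∈-allSubsets S))

allSubsets-unique : (n : ℕ) → Unique (allSubsets n)
allSubsets-unique zero    = [] ∷ []
allSubsets-unique (suc n) = Unique.++⁺
  (Unique.map⁺ ∷-injectiveʳ (allSubsets-unique n))
  (Unique.map⁺ ∷-injectiveʳ (allSubsets-unique n))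
  λ (p , q) → disjoint (∈-map⁻ (outside ∷_) p) (∈-map⁻ (inside ∷_) q)
  where
  disjoint : ∀ {S : Subset (suc n)} →
             ∃[ T ] T ∈ˡ allSubsets n × S ≡ outside ∷ T →
             ¬ (∃[ T ] T ∈ˡ allSubsets n × S ≡ inside ∷ T)
  disjoint (_ , _ , refl) (_ , _ , ())

#maximalCliques : Graph n → ℕ
#maximalCliques {n} G = length (filter (isMaximalClique? G) (allSubsets n))

-- The real inequality 2 ^ (√x / c) ≤ y, with the exponent approximated from
-- below by rationals: p / q ≤ √x / c implies 2 ^ (p / q) ≤ y.
2^[√_/_]≤_ : (x c y : ℕ) → Set
2^[√ x / c ]≤ y = ∀ p q → .{{NonZero q}} → (p * c) ^ 2 ≤ q ^ 2 * x → 2 ^ p ≤ y ^ q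

-- Distinct members are non-isomorphic, so the family is infinite up to
-- isomorphism and its orders are unbounded.
InfiniteFamily : (ℕ → ∃ Graph) → Set
InfiniteFamily F = ∀ i j → i ≢ j → ¬ (proj₂ (F i) ≅ proj₂ (F j))

{-# OPTIONS --safe #-}
module Submission where

-- Let n = 2m. In the cocktail party graph on m pairs, adjacent vertices have n ∸ 2
-- common closed neighbours, and each transversal of the pairs is a maximal clique.
-- Attach an m-clique to each transversal from a family of m + 1 transversals
-- (constant 1, and the m unit vectors). For m ≥ 3 every two vertices from
-- different pairs lie on one of them, hence gain m ≥ 2 common neighbours, and an
-- attached vertex lies in a clique of size 2m = n with its neighbours. For
-- non-adjacent vertices all common neighbours are in the cocktail party graph and
-- miss at least one vertex of it, so they number less than n. Each of the 2 ^ m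
-- transversals still extends to its own maximal clique.

open import Defs
open import Data.Nat using (ℕ; NonZero; _≤_; _+_; _*_; _^_; _/_)
open import Data.Nat.Divisibility using (_∣_)
open import Data.Product using (∃; _×_; proj₁; proj₂; ∃-syntax; Σ-syntax)

open import Data.Bool using (if_then_else_)
open import Data.Fin using (Fin; zero; suc; combine; finToFun; funToFin)
open import Data.Fin.Patterns using (0F; 1F; 2F)
open import Data.Fin.Properties
  using (_≟_; all?; suc-injective; injective⇒≤; ¬∀⟶∃¬; funToFin-finToFin; *↔×; +↔⊎)
open import Data.Fin.Permutation using (↔⇒≡)
open import Data.Fin.Subset using (Subset; _∈_; _∩_; ∣_∣; inside; outside)
open import Data.Fin.Subset.Properties using (x∈p∩q⁺; x∈p∩q⁻)
open import Data.List using (List; length)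
open import Data.List.Membership.Propositional using () renaming (_∈_ to _∈ˡ_)
open import Data.List.Membership.Propositional.Properties using (∈-filter⁺)
open import Data.List.Membership.Setoid.Properties using (index-injective)
open import Data.List.Relation.Unary.Any using (index)
open import Data.Nat using (zero; suc; _<_; z≤n; s≤s)
open import Data.Nat.DivMod using (m*n/n≡m)
open import Data.Nat.Divisibility using (divides)
import Data.Nat.Properties as ℕ
open import Data.Nat.Solver using (module +-*-Solver)
open import Data.Product using (_,_; map₂)
open import Data.Sum using (_⊎_; inj₁; inj₂)
open import Data.Sum.Function.Propositional using (_⊎-↔_)
open import Data.Vec using (_∷_; here; there; tabulate)
open import Data.Vec.Properties using (lookup∘tabulate; lookup⇒[]=; []=⇒lookup)
open import Function using (_∘_; _↔_; mk⇔; Inverse; Injective; Injection)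
open import Function.Construct.Composition using (_↔-∘_)
open import Function.Properties.Inverse using (↔⇒↣; ↔-sym)
open import Relation.Binary.PropositionalEquality
  using (_≡_; _≢_; _≗_; refl; sym; trans; cong; cong₂; subst; setoid; ≢-sym)
open import Relation.Binary.Definitions using (tri<; tri≈; tri>)
open import Relation.Nullary
  using (¬_; Dec; does; yes; no; contradiction; _×-dec_; _→-dec_; _⊎-dec_; ¬?)
open import Relation.Nullary.Decidable
  using (dec-true; dec-false; decidable-stable)
open import Relation.Unary using (Decidable)

private
  variable
    k m n : ℕ

-- Counting in finite subsets and lists.

∈-tabulate⁺ : ∀ {P : Fin n → Set} (P? : Decidable P) {i} → P i → i ∈ tabulate (does ∘ P?)
∈-tabulate⁺ P? {i} Pi =
  lookup⇒[]= i _ (trans (lookup∘tabulate (does ∘ P?) i) (dec-true (P? i) Pi))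

∈-tabulate⁻ : ∀ {P : Fin n → Set} (P? : Decidable P) {i} → i ∈ tabulate (does ∘ P?) → P i
∈-tabulate⁻ P? {i} i∈ with P? i | trans (sym (lookup∘tabulate (does ∘ P?) i)) ([]=⇒lookup i∈)
... | yes Pi | _ = Pi

rank : (p : Subset n) {i : Fin n} → i ∈ p → Fin ∣ p ∣
rank (inside  ∷ p) here       = zero
rank (inside  ∷ p) (there i∈) = suc (rank p i∈)
rank (outside ∷ p) (there i∈) = rank p i∈

rank-injective : (p : Subset n) {i j : Fin n} (i∈ : i ∈ p) (j∈ : j ∈ p) →
                 rank p i∈ ≡ rank p j∈ → i ≡ j
rank-injective (inside  ∷ p) here       here       _  = refl
rank-injective (inside  ∷ p) (there i∈) (there j∈) eq =
  cong suc (rank-injective p i∈ j∈ (suc-injective eq))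
rank-injective (outside ∷ p) (there i∈) (there j∈) eq = cong suc (rank-injective p i∈ j∈ eq)

element : (p : Subset n) → Fin ∣ p ∣ → Fin n
element (inside  ∷ p) zero    = zero
element (inside  ∷ p) (suc x) = suc (element p x)
element (outside ∷ p) x       = suc (element p x)

element∈ : (p : Subset n) (x : Fin ∣ p ∣) → element p x ∈ p
element∈ (inside  ∷ p) zero    = here
element∈ (inside  ∷ p) (suc x) = there (element∈ p x)
element∈ (outside ∷ p) x       = there (element∈ p x)

element-injective : (p : Subset n) → Injective _≡_ _≡_ (element p)
element-injective (inside  ∷ p) {zero}  {zero}  _  = refl
element-injective (inside  ∷ p) {suc x} {suc y} eq =
  cong suc (element-injective p (suc-injective eq))
element-injective (outside ∷ p)                 eq = element-injective p (suc-injective eq)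

injective⇒≤∣p∣ : (p : Subset n) (f : Fin k → Fin n) → Injective _≡_ _≡_ f →
                 (∀ x → f x ∈ p) → k ≤ ∣ p ∣
injective⇒≤∣p∣ p f f-inj f∈ =
  injective⇒≤ {f = rank p ∘ f∈} λ eq → f-inj (rank-injective p (f∈ _) (f∈ _) eq)

-- Choosing preimages injects the members of `p` into `Fin k`. The index `x₀` is never chosen,
-- because `f x₀` lies outside `p`, so it can be added to the image.
covering⇒∣p∣< : (p : Subset n) (f : Fin k → Fin n) → (∀ {i} → i ∈ p → ∃[ x ] f x ≡ i) →
                ∀ x → ¬ f x ∈ p → ∣ p ∣ < k
covering⇒∣p∣< {k = k} p f cover x₀ fx₀∉p = injective⇒≤ {f = g} g-inj
  where
  preimage : ∀ y → ∃[ x ] f x ≡ element p y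
  preimage y = cover (element∈ p y)

  missed : ∀ y → x₀ ≢ proj₁ (preimage y)
  missed y refl = fx₀∉p (subst (_∈ p) (sym (proj₂ (preimage y))) (element∈ p y))

  g : Fin (suc ∣ p ∣) → Fin k
  g zero    = x₀
  g (suc y) = proj₁ (preimage y)

  g-inj : Injective _≡_ _≡_ g
  g-inj {zero}  {zero}  _  = refl
  g-inj {zero}  {suc y} eq = contradiction eq (missed y)
  g-inj {suc y} {zero}  eq = contradiction (sym eq) (missed y)
  g-inj {suc y} {suc z} eq = cong suc (element-injective p
    (trans (sym (proj₂ (preimage y))) (trans (cong f eq) (proj₂ (preimage z)))))

injective⇒≤length : ∀ {A : Set} (xs : List A) (f : Fin k → A) → Injective _≡_ _≡_ f →
                    (∀ x → f x ∈ˡ xs) → k ≤ length xs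
injective⇒≤length xs f f-inj f∈ =
  injective⇒≤ {f = index ∘ f∈} λ eq → f-inj (index-injective (setoid _) (f∈ _) (f∈ _) eq)

funToFin-cong : {f g : Fin m → Fin n} → f ≗ g → funToFin f ≡ funToFin g
funToFin-cong {zero}  f≗g = refl
funToFin-cong {suc m} f≗g = cong₂ combine (f≗g zero) (funToFin-cong (f≗g ∘ suc))

-- Lets codes of transversals be compared entry by entry, without function extensionality.
finToFun-injective : {x y : Fin (n ^ m)} → finToFun {n} {m} x ≗ finToFun y → x ≡ y
finToFun-injective {n} {m} {x} {y} eq =
  trans (sym (funToFin-finToFin {m} x))
        (trans (funToFin-cong eq) (funToFin-finToFin {m} y))

-- Graphs from reflexive symmetric relations.

module ReflexiveRelation
  {V : Set} {n : ℕ} (e : Fin n ↔ V)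
  (_~_ : V → V → Set) (_~?_ : ∀ v w → Dec (v ~ w))
  (~-refl : ∀ {v} → v ~ v) (~-sym : ∀ {v w} → v ~ w → w ~ v)
  where

  open Inverse e using (to; from; strictlyInverseˡ; strictlyInverseʳ)

  -- As `_~_` is reflexive, the closed neighbourhood of `v` is the set of all `u` with
  -- `to v ~ to u`, so counting common neighbours needs no separate case for equal vertices.
  graph : Graph n
  graph = record
    { Adj    = λ u v → u ≢ v × to u ~ to v
    ; adj?   = λ u v → ¬? (u ≟ v) ×-dec (to u ~? to v)
    ; symm   = λ (u≢v , u~v) → ≢-sym u≢v , ~-sym u~v
    ; irrefl = λ u≡v (u≢v , _) → u≢v u≡v
    }

  private
    neighbour? : ∀ v u → Dec (u ≡ v ⊎ Adj graph v u)
    neighbour? v u = (u ≟ v) ⊎-dec adj? graph v u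

  ∈-N⁺ : ∀ {u v} → to v ~ to u → u ∈ graph N[ v ]
  ∈-N⁺ {u} {v} v~u = ∈-tabulate⁺ (neighbour? v) (split (u ≟ v))
    where
    split : Dec (u ≡ v) → u ≡ v ⊎ Adj graph v u
    split (yes u≡v) = inj₁ u≡v
    split (no  u≢v) = inj₂ (≢-sym u≢v , v~u)

  ∈-N⁻ : ∀ {u v} → u ∈ graph N[ v ] → to v ~ to u
  ∈-N⁻ {u} {v} u∈ with ∈-tabulate⁻ (neighbour? v) u∈
  ... | inj₁ refl      = ~-refl
  ... | inj₂ (_ , v~u) = v~u

  from-injective : Injective _≡_ _≡_ from
  from-injective = Injection.injective (↔⇒↣ (↔-sym e))

  common-≥ : ∀ u v (f : Fin k → V) → Injective _≡_ _≡_ f →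
             (∀ x → to u ~ f x × to v ~ f x) → k ≤ ∣ graph N[ u ] ∩ graph N[ v ] ∣
  common-≥ u v f f-inj f~ = injective⇒≤∣p∣ _ (from ∘ f) (f-inj ∘ from-injective) λ x →
    x∈p∩q⁺ ( ∈-N⁺ (subst (to u ~_) (sym (strictlyInverseˡ (f x))) (proj₁ (f~ x)))
           , ∈-N⁺ (subst (to v ~_) (sym (strictlyInverseˡ (f x))) (proj₂ (f~ x))))

  common-< : ∀ u v (f : Fin k → V) → (∀ {w} → to u ~ w → to v ~ w → ∃[ x ] f x ≡ w) →
             ∀ x → ¬ (to u ~ f x × to v ~ f x) → ∣ graph N[ u ] ∩ graph N[ v ] ∣ < k
  common-< u v f cover x₀ missed = covering⇒∣p∣< _ (from ∘ f)
    (λ i∈ → let u∋i , v∋i = x∈p∩q⁻ _ _ i∈ in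
      map₂ (λ eq → trans (cong from eq) (strictlyInverseʳ _))
           (cover (∈-N⁻ u∋i) (∈-N⁻ v∋i)))
    x₀
    (λ fx₀∈ → let u∋ , v∋ = x∈p∩q⁻ _ _ fx₀∈ in
      missed ( subst (to u ~_) (strictlyInverseˡ _) (∈-N⁻ u∋)
             , subst (to v ~_) (strictlyInverseˡ _) (∈-N⁻ v∋)))

  module _ {Q : V → Set} (Q? : Decidable Q) where

    subset : Subset n
    subset = tabulate (does ∘ Q? ∘ to)

    ∈-subset⁺ : ∀ {v} → Q v → from v ∈ subset
    ∈-subset⁺ {v} Qv = ∈-tabulate⁺ (Q? ∘ to) (subst Q (sym (strictlyInverseˡ v)) Qv)

    ∈-subset⁻ : ∀ {v} → from v ∈ subset → Q v
    ∈-subset⁻ {v} v∈ = subst Q (strictlyInverseˡ v) (∈-tabulate⁻ (Q? ∘ to) v∈)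

    subset-maximalClique : (∀ {v w} → Q v → Q w → v ~ w) →
                           (∀ {v} → ¬ Q v → ∃[ w ] Q w × ¬ (v ~ w)) →
                           IsMaximalClique graph subset
    subset-maximalClique Q-clique Q-maximal =
      (λ u v u∈ v∈ u≢v →
        u≢v , Q-clique (∈-tabulate⁻ (Q? ∘ to) u∈) (∈-tabulate⁻ (Q? ∘ to) v∈))
      , λ (T , T-clique , ⊆T , v , v∈T , v∉) →
        let w , Qw , v≁w = Q-maximal (v∉ ∘ ∈-tabulate⁺ (Q? ∘ to))
            -- `T-clique` speaks only of distinct vertices; these two differ since one lies outside
            -- `subset` and the other inside.
            v≢w : v ≢ from w
            v≢w v≡w = v∉ (subst (_∈ subset) (sym v≡w) (∈-subset⁺ Qw))
        in v≁w (subst (to v ~_) (strictlyInverseˡ w)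
             (proj₂ (T-clique v (from w) v∈T (⊆T (∈-subset⁺ Qw)) v≢w)))

-- Cliques attached along a covering array.

-- The closed adjacency relation of the graph: inj₁ (i , s) for s = 0, 1 are the
-- two non-adjacent vertices of the i-th pair of a cocktail party graph, and for
-- each x the vertices inj₂ (x , j) form a clique joined to the transversal S x.
module CoveringArray
  {m t : ℕ} (S : Fin t → Fin m → Fin 2)
  (covering : ∀ {i j} → i ≢ j → ∀ r s → ∃[ x ] S x i ≡ r × S x j ≡ s)
  where

  V : Set
  V = (Fin m × Fin 2) ⊎ (Fin t × Fin m)

  infix 4 _~_ _~?_

  _~_ : V → V → Set
  inj₁ (i , s) ~ inj₁ (j , r) = i ≡ j → s ≡ r
  inj₁ (i , s) ~ inj₂ (x , _) = S x i ≡ s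
  inj₂ (x , _) ~ inj₁ (i , s) = S x i ≡ s
  -- Rows are compared, not indices: non-adjacent attached vertices then come with a coordinate
  -- where their transversals disagree.
  inj₂ (x , _) ~ inj₂ (y , _) = S x ≗ S y

  _~?_ : ∀ v w → Dec (v ~ w)
  inj₁ (i , s) ~? inj₁ (j , r) = (i ≟ j) →-dec (s ≟ r)
  inj₁ (i , s) ~? inj₂ (x , _) = S x i ≟ s
  inj₂ (x , _) ~? inj₁ (i , s) = S x i ≟ s
  inj₂ (x , _) ~? inj₂ (y , _) = all? λ i → S x i ≟ S y i

  ~-refl : ∀ {v} → v ~ v
  ~-refl {inj₁ _} _ = refl
  ~-refl {inj₂ _} _ = refl

  ~-sym : ∀ {v w} → v ~ w → w ~ v
  ~-sym {inj₁ _} {inj₁ _} v~w = sym ∘ v~w ∘ sym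
  ~-sym {inj₁ _} {inj₂ _} v~w = v~w
  ~-sym {inj₂ _} {inj₁ _} v~w = v~w
  ~-sym {inj₂ _} {inj₂ _} v~w = sym ∘ v~w

  order : ℕ
  order = m * 2 + t * m

  encoding : Fin order ↔ V
  encoding = (*↔× ⊎-↔ *↔×) ↔-∘ +↔⊎

  open ReflexiveRelation encoding _~_ _~?_ (λ {v} → ~-refl {v}) (λ {v} {w} → ~-sym {v} {w}) public
  open Inverse encoding using (to)

  -- The index type has `m * 2` elements, the threshold, and is also the type of cocktail party
  -- vertices, so such a vertex can be its own index.
  ManyCommon : V → V → Set
  ManyCommon v w = Σ[ f ∈ (Fin m × Fin 2 → V) ]
    Injective _≡_ _≡_ f × (∀ x → v ~ f x × w ~ f x)

  -- The maximal clique extending the transversal `T`: it also takes every attached vertex whose row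
  -- is `T`, possibly none.
  Clique : (Fin m → Fin 2) → V → Set
  Clique T (inj₁ (i , s)) = T i ≡ s
  Clique T (inj₂ (x , _)) = S x ≗ T

  Clique? : ∀ T → Decidable (Clique T)
  Clique? T (inj₁ (i , s)) = T i ≟ s
  Clique? T (inj₂ (x , _)) = all? λ i → S x i ≟ T i

  Clique-clique : ∀ T {v w} → Clique T v → Clique T w → v ~ w
  Clique-clique T {inj₁ _}       {inj₁ _}       p q refl = trans (sym p) q
  Clique-clique T {inj₁ (i , _)} {inj₂ _}       p q      = trans (q i) p
  Clique-clique T {inj₂ _}       {inj₁ (i , _)} p q      = trans (p i) q
  Clique-clique T {inj₂ _}       {inj₂ _}       p q i    = trans (p i) (sym (q i))

  -- The witness always lies on the transversal: in the pair of `v` itself, or in a pair where the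
  -- row of `v` differs from `T`.
  Clique-maximal : ∀ T {v} → ¬ Clique T v → ∃[ w ] Clique T w × ¬ (v ~ w)
  Clique-maximal T {inj₁ (i , s)} ¬p = inj₁ (i , T i) , refl , λ v~w → ¬p (sym (v~w refl))
  Clique-maximal T {inj₂ (x , _)} ¬p =
    let i , ≢ = ¬∀⟶∃¬ m _ (λ i → S x i ≟ T i) ¬p in inj₁ (i , T i) , refl , ≢

  -- The transversal `S x` and the `m` vertices `inj₂ (x , l)` are `m * 2` members of one clique
  -- that contains `v` and `w`.
  clique-many : ∀ x {v w} → Clique (S x) v → Clique (S x) w → ManyCommon v w
  clique-many x {v} {w} p q = f , f-inj ,
    λ y → Clique-clique (S x) {v} {f y} p (f-clique y) , Clique-clique (S x) {w} {f y} q (f-clique y)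
    where
    f : Fin m × Fin 2 → V
    f (l , 0F) = inj₁ (l , S x l)
    f (l , 1F) = inj₂ (x , l)

    f-inj : Injective _≡_ _≡_ f
    f-inj {_ , 0F} {_ , 0F} refl = refl
    f-inj {_ , 0F} {_ , 1F} ()
    f-inj {_ , 1F} {_ , 0F} ()
    f-inj {_ , 1F} {_ , 1F} refl = refl

    f-clique : ∀ y → Clique (S x) (f y)
    f-clique (_ , 0F)   = refl
    f-clique (_ , 1F) _ = refl

  -- The two common neighbours missing in the cocktail party graph are replaced by
  -- vertices of a clique attached to a transversal through both given vertices.
  pair-many : ∀ {i j} → i ≢ j → ∀ r s → ManyCommon (inj₁ (i , r)) (inj₁ (j , s))
  pair-many {i} {j} i≢j r s = f , f-inj , f~
    where
    x : Fin t
    x = proj₁ (covering i≢j r s)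

    Common : Fin m × Fin 2 → Set
    Common y = inj₁ (i , r) ~ inj₁ y × inj₁ (j , s) ~ inj₁ y

    common? : Decidable Common
    common? y = (inj₁ (i , r) ~? inj₁ y) ×-dec (inj₁ (j , s) ~? inj₁ y)

    g : ∀ y → Dec (Common y) → V
    g y       (yes _) = inj₁ y
    -- Only the pair index survives the replacement, so injectivity requires at most one uncommon
    -- vertex per pair.
    g (l , _) (no  _) = inj₂ (x , l)

    f : Fin m × Fin 2 → V
    f y = g y (common? y)

    f~ : ∀ y → inj₁ (i , r) ~ f y × inj₁ (j , s) ~ f y
    f~ y with common? y
    ... | yes c = c
    ... | no  _ = proj₂ (covering i≢j r s)

    other : ∀ {q q′ z : Fin 2} → z ≢ q → z ≢ q′ → q ≡ q′
    other {0F} {0F} {_}  _ _ = refl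
    other {1F} {1F} {_}  _ _ = refl
    other {0F} {1F} {0F} p _ = contradiction refl p
    other {0F} {1F} {1F} _ p = contradiction refl p
    other {1F} {0F} {0F} _ p = contradiction refl p
    other {1F} {0F} {1F} p _ = contradiction refl p

    uncommon : ∀ {l q} → ¬ Common (l , q) → (i ≡ l × r ≢ q) ⊎ (j ≡ l × s ≢ q)
    uncommon {l} {q} ¬c with i ≟ l | j ≟ l
    ... | yes refl | yes refl = contradiction refl i≢j
    ... | yes refl | no j≢l   = inj₁ (refl , λ r≡q → ¬c ((λ _ → r≡q) , λ j≡l → contradiction j≡l j≢l))
    ... | no i≢l   | yes refl = inj₂ (refl , λ s≡q → ¬c ((λ i≡l → contradiction i≡l i≢l) , λ _ → s≡q))
    ... | no i≢l   | no j≢l   =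
      contradiction ((λ i≡l → contradiction i≡l i≢l) , λ j≡l → contradiction j≡l j≢l) ¬c

    -- The uncommon vertices are the partners of `(i , r)` and `(j , s)`, and `i ≢ j` puts these in
    -- different pairs.
    uncommon-unique : ∀ {l q q′} → ¬ Common (l , q) → ¬ Common (l , q′) → q ≡ q′
    uncommon-unique ¬c ¬c′ with uncommon ¬c | uncommon ¬c′
    ... | inj₁ (_ , r≢q)    | inj₁ (_ , r≢q′) = other r≢q r≢q′
    ... | inj₂ (_ , s≢q)    | inj₂ (_ , s≢q′) = other s≢q s≢q′
    ... | inj₁ (refl , _)   | inj₂ (refl , _) = contradiction refl i≢j
    ... | inj₂ (refl , _)   | inj₁ (refl , _) = contradiction refl i≢j

    f-inj : Injective _≡_ _≡_ f
    f-inj {y} {y′} eq with common? y | common? y′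
    f-inj refl | yes _ | yes _  = refl
    f-inj refl | no ¬c | no ¬c′ = cong (_ ,_) (uncommon-unique ¬c ¬c′)

  adjacent⇒many : ∀ {v w} → v ≢ w → v ~ w → ManyCommon v w
  adjacent⇒many {inj₁ (i , r)} {inj₁ (j , s)} v≢w v~w =
    pair-many (λ i≡j → v≢w (cong inj₁ (cong₂ _,_ i≡j (v~w i≡j)))) r s
  adjacent⇒many {inj₁ _}       {inj₂ (x , _)} _ v~w = clique-many x v~w (λ _ → refl)
  adjacent⇒many {inj₂ (x , _)} {inj₁ _}       _ v~w = clique-many x (λ _ → refl) v~w
  adjacent⇒many {inj₂ (x , _)} {inj₂ (y , _)} _ v~w = clique-many x (λ _ → refl) (sym ∘ v~w)

  FewCommon : V → V → Set
  FewCommon v w =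
    (∀ {z} → v ~ z → w ~ z → ∃[ y ] inj₁ y ≡ z) × ∃[ y ] ¬ (v ~ inj₁ y × w ~ inj₁ y)

  FewCommon-sym : ∀ {v w} → FewCommon v w → FewCommon w v
  FewCommon-sym (cover , y , missed) = (λ p q → cover q p) , y , λ (p , q) → missed (q , p)

  mixed-few : ∀ {i s x l} → S x i ≢ s → FewCommon (inj₁ (i , s)) (inj₂ (x , l))
  mixed-few {i} {s} ≢s =
      (λ { {inj₁ y} _ _ → y , refl
         ; {inj₂ _} p q → contradiction (trans (q i) p) ≢s })
    , (i , s) , λ (_ , q) → ≢s q

  -- An attached common neighbour would put `v` and `w` into the clique of its row and make them
  -- adjacent. The missed vertex is a given cocktail party vertex or, for two attached vertices,
  -- lies in a pair where their rows differ.
  nonadjacent⇒few : ∀ {v w} → ¬ (v ~ w) → FewCommon v w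
  nonadjacent⇒few {inj₁ (i , r)} {inj₁ (j , s)} v≁w =
      (λ { {inj₁ y} _ _ → y , refl
         ; {inj₂ _} p q → contradiction (λ { refl → trans (sym p) q }) v≁w })
    , (i , r) , λ (_ , q) → v≁w (sym ∘ q ∘ sym)
  nonadjacent⇒few {inj₁ _} {inj₂ _} v≁w = mixed-few v≁w
  nonadjacent⇒few {inj₂ _} {inj₁ _} v≁w = FewCommon-sym (mixed-few v≁w)
  nonadjacent⇒few {inj₂ (x , _)} {inj₂ (y , _)} v≁w =
    let i , ≢ = ¬∀⟶∃¬ m _ (λ i → S x i ≟ S y i) v≁w in
      (λ { {inj₁ z} _ _ → z , refl
         ; {inj₂ _} p q → contradiction (λ i → trans (p i) (sym (q i))) v≁w })
    , (i , S x i) , λ (_ , q) → ≢ (sym q)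

  polished : IntersectionPolished (m * 2) graph
  polished u v = mk⇔
    (λ (u≢v , many) → u≢v , decidable-stable (to u ~? to v) λ u≁v →
      let cover , y , missed = nonadjacent⇒few {to u} {to v} u≁v in
      ℕ.≤⇒≯ many (common-< u v (inj₁ ∘ pair)
        (λ p q → let z , eq = cover p q in unpair z , trans (cong inj₁ (pair-unpair z)) eq)
        (unpair y)
        (missed ∘ subst (λ z → to u ~ inj₁ z × to v ~ inj₁ z) (pair-unpair y))))
    (λ (u≢v , u~v) → u≢v ,
      let f , f-inj , f~ = adjacent⇒many (u≢v ∘ Injection.injective (↔⇒↣ encoding)) u~v in
      common-≥ u v (f ∘ pair) (Injection.injective (↔⇒↣ *↔×) ∘ f-inj) (f~ ∘ pair))
    where
    open Inverse (*↔× {m} {2}) using ()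
      renaming (to to pair; from to unpair; strictlyInverseˡ to pair-unpair)

  -- `T` can be read off its clique, which contains `inj₁ (i , s)` exactly when `T i ≡ s`; hence
  -- distinct codes in `Fin (2 ^ m)` give distinct cliques.
  maximalCliques : 2 ^ m ≤ #maximalCliques graph
  maximalCliques = injective⇒≤length _ (clique ∘ finToFun)
    (λ {x} {y} eq → finToFun-injective {m = m} λ i → sym
      (∈-subset⁻ (Clique? (finToFun y))
        (subst (_ ∈_) eq (∈-subset⁺ (Clique? (finToFun x)) {inj₁ (i , finToFun x i)} refl))))
    λ x → ∈-filter⁺ (isMaximalClique? graph) (∈-allSubsets _)
      (subset-maximalClique (Clique? (finToFun x))
        (λ {v} {w} → Clique-clique (finToFun x) {v} {w}) (λ {v} → Clique-maximal (finToFun x) {v}))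
    where
    clique : (Fin m → Fin 2) → Subset order
    clique T = subset (Clique? T)

-- The covering array of unit vectors.

unitArray : Fin (suc m) → Fin m → Fin 2
unitArray zero    _ = 1F
unitArray (suc x) i = if does (x ≟ i) then 1F else 0F

-- Supplies a unit vector that vanishes in both columns `i` and `j`; this is what `3 ≤ m` is for.
third : 3 ≤ m → (i j : Fin m) → ∃[ l ] l ≢ i × l ≢ j
third (s≤s (s≤s (s≤s _))) zero          zero          = 1F , (λ ()) , λ ()
third (s≤s (s≤s (s≤s _))) zero          (suc zero)    = 2F , (λ ()) , λ ()
third (s≤s (s≤s (s≤s _))) zero          (suc (suc _)) = 1F , (λ ()) , λ ()
third (s≤s (s≤s (s≤s _))) (suc zero)    zero          = 2F , (λ ()) , λ ()
third (s≤s (s≤s (s≤s _))) (suc (suc _)) zero          = 1F , (λ ()) , λ ()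
third (s≤s (s≤s (s≤s _))) (suc _)       (suc _)       = 0F , (λ ()) , λ ()

unitArray-diagonal : ∀ (i : Fin m) → unitArray (suc i) i ≡ 1F
unitArray-diagonal i rewrite dec-true (i ≟ i) refl = refl

unitArray-offDiagonal : ∀ {x i : Fin m} → x ≢ i → unitArray (suc x) i ≡ 0F
unitArray-offDiagonal {x = x} {i} x≢i rewrite dec-false (x ≟ i) x≢i = refl

unitArray-covering : 3 ≤ m → {i j : Fin m} → i ≢ j → ∀ r s →
                     ∃[ x ] unitArray x i ≡ r × unitArray x j ≡ s
unitArray-covering 3≤m {i} {j} _ 0F 0F =
  let l , l≢i , l≢j = third 3≤m i j in
  suc l , unitArray-offDiagonal l≢i , unitArray-offDiagonal l≢j
unitArray-covering _ {i} {j} i≢j 1F 0F = suc i , unitArray-diagonal i , unitArray-offDiagonal i≢j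
unitArray-covering _ {i} {j} i≢j 0F 1F = suc j , unitArray-offDiagonal (≢-sym i≢j) , unitArray-diagonal j
unitArray-covering _ _ 1F 1F = zero , refl , refl

module UnitArray (m : ℕ) (3≤m : 3 ≤ m) = CoveringArray (unitArray {m}) (unitArray-covering 3≤m)

-- Arithmetic of the order and the exponential bound.

order-closed : ∀ m → m * 2 + suc m * m ≡ m * m + 3 * m
order-closed = solve 1 (λ m → m :* con 2 :+ (con 1 :+ m) :* m := m :* m :+ con 3 :* m) refl
  where open +-*-Solver

-- At the even number `m * 2` both quotients are exact, so truncated division loses nothing.
order-halves : ∀ m → m * 2 + suc m * m ≡ (m * 2) ^ 2 / 4 + 3 * (m * 2) / 2
order-halves m = trans (order-closed m) (sym (cong₂ _+_
  (trans (cong (_/ 4) (square m)) (m*n/n≡m (m * m) 4))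
  (trans (cong (_/ 2) (sym (ℕ.*-assoc 3 m 2))) (m*n/n≡m (3 * m) 2))))
  where
  open +-*-Solver

  square : ∀ m → (m * 2) ^ 2 ≡ m * m * 4
  square = solve 1 (λ m → (m :* con 2) :^ 2 := m :* m :* con 4) refl

order-strictMono : ∀ {a b} → a < b → a * 2 + suc a * a < b * 2 + suc b * b
order-strictMono a<b =
  ℕ.+-mono-<-≤ (ℕ.*-monoˡ-< 2 a<b) (ℕ.*-mono-≤ (s≤s (ℕ.<⇒≤ a<b)) (ℕ.<⇒≤ a<b))

-- Separates the members of the infinite family: isomorphic graphs have equal order, and the order
-- determines `m`.
order-injective : ∀ {a b} → a * 2 + suc a * a ≡ b * 2 + suc b * b → a ≡ b
order-injective {a} {b} eq with ℕ.<-cmp a b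
... | tri< a<b _ _ = contradiction eq (ℕ.<⇒≢ (order-strictMono a<b))
... | tri≈ _ a≡b _ = a≡b
... | tri> _ _ b<a = contradiction (sym eq) (ℕ.<⇒≢ (order-strictMono b<a))

m≤m*m : ∀ m → m ≤ m * m
m≤m*m zero      = z≤n
m≤m*m m@(suc _) = ℕ.m≤m*n m m

-- For the order `N` this says `√N / 2 ≤ m`, which is the source of the constant `2` in the
-- exponential bound.
order-≤-square : ∀ m → m * 2 + suc m * m ≤ (m * 2) ^ 2
order-≤-square m = begin
  m * 2 + suc m * m     ≡⟨ order-closed m ⟩
  m * m + 3 * m         ≤⟨ ℕ.+-monoʳ-≤ (m * m) (ℕ.*-monoʳ-≤ 3 (m≤m*m m)) ⟩
  m * m + 3 * (m * m)   ≡⟨ square m ⟩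
  (m * 2) ^ 2           ∎
  where
  open ℕ.≤-Reasoning
  open +-*-Solver

  square : ∀ m → m * m + 3 * (m * m) ≡ (m * 2) ^ 2
  square = solve 1 (λ m → m :* m :+ con 3 :* (m :* m) := (m :* con 2) :^ 2) refl

^2-cancel-≤ : ∀ {a b} → a ^ 2 ≤ b ^ 2 → a ≤ b
^2-cancel-≤ a²≤b² = ℕ.≮⇒≥ λ b<a → ℕ.≤⇒≯ a²≤b² (ℕ.^-monoˡ-< 2 b<a)

exponential : ∀ {m x y} → x ≤ (m * 2) ^ 2 → 2 ^ m ≤ y → 2^[√ x / 2 ]≤ y
exponential {m} {x} {y} x≤ 2^m≤y p q p≤ = begin
  2 ^ p         ≤⟨ ℕ.^-monoʳ-≤ 2 p≤mq ⟩
  2 ^ (m * q)   ≡⟨ ℕ.^-*-assoc 2 m q ⟨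
  (2 ^ m) ^ q   ≤⟨ ℕ.^-monoˡ-≤ q 2^m≤y ⟩
  y ^ q         ∎
  where
  open ℕ.≤-Reasoning
  open +-*-Solver

  rearrange : ∀ m q → q ^ 2 * (m * 2) ^ 2 ≡ (m * q * 2) ^ 2
  rearrange = solve 2 (λ m q → q :^ 2 :* (m :* con 2) :^ 2 := (m :* q :* con 2) :^ 2) refl

  p≤mq : p ≤ m * q
  -- Squaring avoids the root: `p / q ≤ √x / 2 ≤ m` becomes a comparison of `(p * 2) ^ 2` with
  -- `(m * q * 2) ^ 2`.
  p≤mq = ℕ.*-cancelʳ-≤ p (m * q) 2 (^2-cancel-≤ (begin
    (p * 2) ^ 2            ≤⟨ p≤ ⟩
    q ^ 2 * x              ≤⟨ ℕ.*-monoʳ-≤ (q ^ 2) x≤ ⟩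
    q ^ 2 * (m * 2) ^ 2    ≡⟨ rearrange m q ⟩
    (m * q * 2) ^ 2        ∎))

-- The graphs for even `n` and the infinite family.

polishedGraph : ∀ n → 2 ∣ n → 6 ≤ n → Σ[ G ∈ Graph (n ^ 2 / 4 + 3 * n / 2) ]
                IntersectionPolished n G × 2 ^ (n / 2) ≤ #maximalCliques G
polishedGraph _ (divides m refl) 6≤n =
  -- The type of `G` depends on its order, so the whole package is transported: the outer `subst`
  -- changes the order, the inner one the exponent.
  subst (λ N → Σ[ G ∈ Graph N ] IntersectionPolished (m * 2) G × 2 ^ (m * 2 / 2) ≤ #maximalCliques G)
        (order-halves m)
        (subst (λ h → Σ[ G ∈ Graph (m * 2 + suc m * m) ]
                        IntersectionPolished (m * 2) G × 2 ^ h ≤ #maximalCliques G)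
               (sym (m*n/n≡m m 2))
               (graph , polished , maximalCliques))
  where open UnitArray m (ℕ.*-cancelʳ-≤ 3 m 2 6≤n)

theorem4 : (∀ (n : ℕ) → 2 ∣ n → 6 ≤ n →
    Σ[ G ∈ Graph (n ^ 2 / 4 + 3 * n / 2) ]
    IntersectionPolished n G × 2 ^ (n / 2) ≤ #maximalCliques G)
    ×
    (Σ[ F ∈ (ℕ → ∃ Graph) ]
    InfiniteFamily F ×
    (∀ i → ∃[ k ] IntersectionPolished k (proj₂ (F i))) ×
    (∃[ c ] NonZero c ×
    (∀ i → 2^[√ proj₁ (F i) / c ]≤ #maximalCliques (proj₂ (F i)))))
theorem4 =
    polishedGraph
  , (λ i → order (i + 3) (3≤ i) , graph (i + 3) (3≤ i))
  , (λ i j i≢j (f , _) → i≢j (ℕ.+-cancelʳ-≡ 3 i j (order-injective (↔⇒≡ f))))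
  , (λ i → (i + 3) * 2 , polished (i + 3) (3≤ i))
  , 2 , _
  , λ i → exponential {i + 3} (order-≤-square (i + 3)) (maximalCliques (i + 3) (3≤ i))
  where
  -- i + 3 is neutral, whereas the numeral prefix of 3 + i lets allSubsets unfold.
  open UnitArray using (order; graph; polished; maximalCliques)

  3≤ : ∀ i → 3 ≤ i + 3
  3≤ = ℕ.m≤n+m 3
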